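{- Let $p$ be an odd prime with $p\neq 5$. Then $E_{Q_p,\mathbf 1}=p+2$.
   Context: For an odd prime $p$, $\mathbb Z_p=\mathbb Z/p\mathbb Z$, $U(p)$ is its group of units, and $Q_p=\{x^2:x\in U(p)\}$. A sequence of length $k$ in $\mathbb Z_p$ is an element of $\mathbb Z_p^k$. A sequence $(x_1,\ldots,x_k)$ in $\mathbb Z_p$ is called a $(Q_p,\mathbf 1)$-weighted zero-sum sequence if there exist $a_1,\ldots,a_k\in Q_p$ such that $a_1x_1+\cdots+a_kx_k=0$ and $a_1+\cdots+a_k=0$ in $\mathbb Z_p$. The constant $E_{Q_p,\mathbf 1}$ is the least positive integer $k$ such that every sequence in $\mathbb Z_p$ of length $k$ has a $(Q_p,\mathbf 1)$-weighted zero-sum subsequence of length $p$ (terms not necessarily consecutive). -}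

module Defs where

open import Data.Fin using (Fin; toℕ)
open import Data.List.Relation.Binary.Sublist.Propositional using (_⊆_)
open import Data.Nat using (ℕ; NonZero; _≤_; _<_)
import Data.Nat as ℕ
open import Data.Nat.DivMod using (_mod_)
open import Data.Product using (Σ-syntax; ∃-syntax; _×_)
open import Data.Vec using (Vec; foldr′; toList; zipWith)
open import Data.Vec.Relation.Unary.All using (All)
open import Relation.Binary.PropositionalEquality using (_≡_)

-- ℤ/nℤ is represented by the least non-negative residues, so that
-- propositional equality is equality in ℤ/nℤ.

ℤmod : ℕ → Set
ℤmod n = Fin n

module _ {n : ℕ} .{{_ : NonZero n}} where

  infixl 6 _+_
  infixl 7 _*_

  0# 1# : ℤmod n
  0# = 0 mod n
  1# = 1 mod n

  _+_ _*_ : ℤmod n → ℤmod n → ℤmod n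
  x + y = (toℕ x ℕ.+ toℕ y) mod n
  x * y = (toℕ x ℕ.* toℕ y) mod n

  sum : ∀ {k} → Vec (ℤmod n) k → ℤmod n
  sum = foldr′ _+_ 0#

  IsUnit : ℤmod n → Set
  IsUnit x = ∃[ y ] x * y ≡ 1#

  Q : ℤmod n → Set
  Q a = ∃[ x ] IsUnit x × a ≡ x * x

  IsWeightedZeroSum : ∀ {k} → Vec (ℤmod n) k → Set
  IsWeightedZeroSum {k} xs =
    Σ[ as ∈ Vec (ℤmod n) k ] All Q as × sum (zipWith _*_ as xs) ≡ 0# × sum as ≡ 0#

-- _⊆_ on lists is the order-preserving embedding (not mere containment of
-- elements), so ys selects n distinct positions of xs.

HasWeightedZeroSumSubsequence : ∀ (n : ℕ) .{{_ : NonZero n}} {k} → Vec (ℤmod n) k → Set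
HasWeightedZeroSumSubsequence n xs =
  Σ[ ys ∈ Vec (ℤmod n) n ] toList ys ⊆ toList xs × IsWeightedZeroSum ys

IsLeastPositive : (ℕ → Set) → ℕ → Set
IsLeastPositive P k = 0 < k × P k × (∀ j → 0 < j → P j → k ≤ j)

-- The constant E is given by its graph: E[Q,1]≡ n k says that the least
-- positive integer with the defining property exists and equals k.

E[Q,1]≡ : (n : ℕ) .{{_ : NonZero n}} → ℕ → Set
E[Q,1]≡ n =
  IsLeastPositive λ k → (xs : Vec (ℤmod n) k) → HasWeightedZeroSumSubsequence n xs

{-# OPTIONS --safe #-}
module Submission where

-- For the upper bound let p ≥ 7. Then 1, 4, 9 are three distinct elements of Q,
-- so some element of Q avoids any two prescribed values. Pigeonhole solves
-- u x² + v y² = c, and moving along the conic makes both coordinates nonzero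
-- when c ≠ 0: hence uQ + vQ contains every nonzero c, and uQ + vQ + wQ is
-- everything. Among p + 2 residues either some value x occurs three times, or
-- x, x, y, y, z occur for some distinct x, y, z. In the first case weights for the other
-- terms kill Σ a (xᵢ - x), and copies of x then kill Σ a. In the second case
-- the pairs contribute every c (x, 1) + d (y, 1) with c, d ≠ 0, so it suffices
-- that the rest contributes a vector off the lines of (x, 1) and (y, 1), which
-- is arranged by the weight of z. The prime 3 has Q = {1} and is finite.
--
-- For the lower bound, 1, - w, 0, …, 0 with w a nonsquare has length p + 1.

open import Algebra.Bundles using (CommutativeRing)
open import Algebra.Structures using (IsCommutativeRing)
import Algebra.Solver.Ring
open import Algebra.Solver.Ring.AlmostCommutativeRing
  using (fromCommutativeRing; _-Raw-AlmostCommutative⟶_)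
open import Data.Fin as Fin using (Fin; toℕ)
import Data.Fin.Properties as Fin
open import Data.Integer as ℤ using (ℤ; -[1+_]; _⊖_) renaming (+_ to pos)
import Data.Integer.Properties as ℤ
open import Data.List.Base as List using (List; []; _∷_; _++_; length; replicate)
import Data.List.Properties as List
import Data.List.Membership.DecPropositional as DecMembership
open import Data.List.Membership.Propositional using (_∈_)
open import Data.List.Membership.Propositional.Properties using (∈-∃++; ∈-lookup)
open import Data.List.Relation.Binary.Permutation.Propositional as Perm
  using (_↭_; prep; swap; ↭-sym; ↭-trans; ↭-refl)
open import Data.List.Relation.Binary.Permutation.Propositional.Properties
  using (shift; ↭-length; ∈-resp-↭)
open import Data.List.Relation.Binary.Sublist.Propositional
  using (_⊆_; []; _∷_; _∷ʳ_; minimum; ⊆-trans)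
open import Data.List.Relation.Unary.All as All using (All; []; _∷_)
open import Data.List.Relation.Unary.All.Properties using (replicate⁺; ¬Any⇒All¬)
open import Data.List.Relation.Unary.AllPairs using ([]; _∷_)
open import Data.List.Relation.Unary.Any using (here; there)
open import Data.List.Relation.Unary.Unique.Propositional using (Unique)
open import Data.Maybe using (map)
open import Data.Nat as ℕ using (ℕ; suc; zero; _≤_; _<_; s≤s; z≤n; NonZero)
import Data.Nat.Properties as ℕ
open import Data.Nat.Coprimality using (prime⇒coprime; coprime-Bézout)
open import Data.Nat.DivMod as ℕ using (_mod_; _%_)
open import Data.Nat.Divisibility as ℕ using (_∣_; _∤_)
open import Data.Nat.GCD using (module Bézout)
open import Data.Nat.Primality using (Prime; ¬prime[0]; ¬prime[1]; euclidsLemma)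
open import Data.Product using (Σ-syntax; ∃-syntax; ∃₂; _×_; _,_; proj₁; proj₂)
open import Data.Sum using (_⊎_; inj₁; inj₂; [_,_]′)
open import Data.Vec as Vec using (Vec; []; _∷_; toList)
import Data.Vec.Properties as Vec
open import Data.Vec.Relation.Unary.All as VecAll using ([]; _∷_)
open import Function using (_∘_)
open import Level using (0ℓ)
open import Relation.Binary.Consequences using (dec⇒weaklyDec)
open import Relation.Binary.Definitions using (DecidableEquality)
open import Relation.Binary.PropositionalEquality
open import Relation.Nullary using (yes; no; ¬?; contradiction)
open import Relation.Nullary.Decidable using (from-yes; toWitness; _→-dec_)

-- A ring solver with integer coefficients over an abstract commutative ring.

module IntegerCoefficients
  {A : Set} {_+_ _*_ : A → A → A} { -_ : A → A} {0# 1# : A}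
  (isCommutativeRing : IsCommutativeRing _≡_ _+_ _*_ -_ 0# 1#)
  where

  ring : CommutativeRing 0ℓ 0ℓ
  ring = record { isCommutativeRing = isCommutativeRing }

  open CommutativeRing ring
    using (semiring; +-comm; +-assoc; +-identityˡ; +-identityʳ; -‿inverseʳ; +-group)
  open import Algebra.Properties.Ring (CommutativeRing.ring ring)
    using (-‿distribˡ-*; -‿distribʳ-*)
  open import Algebra.Properties.Group +-group using (ε⁻¹≈ε; ⁻¹-involutive)
  open import Algebra.Properties.AbelianGroup (CommutativeRing.+-abelianGroup ring)
    using (⁻¹-∙-comm)
  open import Algebra.Properties.Semiring.Mult semiring
    using (×-homo-+; ×1-homo-*) renaming (_×_ to _·_)
  open import Algebra.Properties.CommutativeSemigroup
    (CommutativeRing.+-commutativeSemigroup ring) using (interchange)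
  open ≡-Reasoning

  -- The canonical homomorphism from the integers. The solver compares coefficients, and integers
  -- can be compared, whereas `A` carries no decision procedure here.
  ⟦_⟧ : ℤ → A
  ⟦ pos n ⟧    = n · 1#
  ⟦ -[1+ n ] ⟧ = - (suc n · 1#)

  ⟦⟧-neg : ∀ i → ⟦ ℤ.- i ⟧ ≡ - ⟦ i ⟧
  ⟦⟧-neg (pos zero)    = sym ε⁻¹≈ε
  ⟦⟧-neg (pos (suc n)) = refl
  ⟦⟧-neg -[1+ n ]      = sym (⁻¹-involutive _)

  ⟦⟧-⊖ : ∀ m n → ⟦ m ⊖ n ⟧ ≡ (m · 1#) + (- (n · 1#))
  ⟦⟧-⊖ m zero = begin
    m · 1#              ≡⟨ +-identityʳ _ ⟨
    (m · 1#) + 0#       ≡⟨ cong ((m · 1#) +_) ε⁻¹≈ε ⟨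
    (m · 1#) + (- 0#)   ∎
  ⟦⟧-⊖ zero (suc n) = sym (+-identityˡ _)
  ⟦⟧-⊖ (suc m) (suc n) = begin
    ⟦ suc m ⊖ suc n ⟧                       ≡⟨ cong ⟦_⟧ (ℤ.[1+m]⊖[1+n]≡m⊖n m n) ⟩
    ⟦ m ⊖ n ⟧                               ≡⟨ ⟦⟧-⊖ m n ⟩
    M + (- N)                               ≡⟨ +-identityˡ _ ⟨
    -- `1# + (- 1#)` is inserted so that `interchange` can hand one summand to each side.
    0# + (M + (- N))                        ≡⟨ cong (_+ (M + (- N))) (-‿inverseʳ 1#) ⟨
    (1# + (- 1#)) + (M + (- N))             ≡⟨ interchange 1# (- 1#) M (- N) ⟩
    (1# + M) + ((- 1#) + (- N))             ≡⟨ cong ((1# + M) +_) (⁻¹-∙-comm 1# N) ⟩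
    (1# + M) + (- (1# + N))                 ∎
    where
    M = m · 1#
    N = n · 1#

  ⟦⟧-+ : ∀ i j → ⟦ i ℤ.+ j ⟧ ≡ ⟦ i ⟧ + ⟦ j ⟧
  ⟦⟧-+ (pos m)  (pos n)  = ×-homo-+ 1# m n
  ⟦⟧-+ (pos m)  -[1+ n ] = ⟦⟧-⊖ m (suc n)
  ⟦⟧-+ -[1+ m ] (pos n)  = trans (⟦⟧-⊖ n (suc m)) (+-comm _ _)
  ⟦⟧-+ -[1+ m ] -[1+ n ] = begin
    - ((2 ℕ.+ (m ℕ.+ n)) · 1#)               ≡⟨ cong (λ k → - (suc k · 1#)) (ℕ.+-suc m n) ⟨
    - ((suc m ℕ.+ suc n) · 1#)               ≡⟨ cong -_ (×-homo-+ 1# (suc m) (suc n)) ⟩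
    - ((suc m · 1#) + (suc n · 1#))          ≡⟨ ⁻¹-∙-comm _ _ ⟨
    (- (suc m · 1#)) + (- (suc n · 1#))      ∎

  ⟦⟧-pos* : ∀ m j → ⟦ pos m ℤ.* j ⟧ ≡ ⟦ pos m ⟧ * ⟦ j ⟧
  ⟦⟧-pos* m (pos n) = trans (cong ⟦_⟧ (sym (ℤ.pos-* m n))) (×1-homo-* m n)
  ⟦⟧-pos* m -[1+ n ] = begin
    ⟦ pos m ℤ.* -[1+ n ] ⟧            ≡⟨ cong ⟦_⟧ (ℤ.neg-distribʳ-* (pos m) (pos (suc n))) ⟨
    ⟦ ℤ.- (pos m ℤ.* pos (suc n)) ⟧   ≡⟨ ⟦⟧-neg (pos m ℤ.* pos (suc n)) ⟩
    - ⟦ pos m ℤ.* pos (suc n) ⟧       ≡⟨ cong -_ (⟦⟧-pos* m (pos (suc n))) ⟩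
    - (⟦ pos m ⟧ * ⟦ pos (suc n) ⟧)   ≡⟨ -‿distribʳ-* _ _ ⟩
    ⟦ pos m ⟧ * (- ⟦ pos (suc n) ⟧)   ∎

  ⟦⟧-* : ∀ i j → ⟦ i ℤ.* j ⟧ ≡ ⟦ i ⟧ * ⟦ j ⟧
  ⟦⟧-* (pos m)  j = ⟦⟧-pos* m j
  ⟦⟧-* -[1+ m ] j = begin
    ⟦ -[1+ m ] ℤ.* j ⟧             ≡⟨ cong ⟦_⟧ (ℤ.neg-distribˡ-* (pos (suc m)) j) ⟨
    ⟦ ℤ.- (pos (suc m) ℤ.* j) ⟧    ≡⟨ ⟦⟧-neg (pos (suc m) ℤ.* j) ⟩
    - ⟦ pos (suc m) ℤ.* j ⟧        ≡⟨ cong -_ (⟦⟧-pos* (suc m) j) ⟩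
    - (⟦ pos (suc m) ⟧ * ⟦ j ⟧)    ≡⟨ -‿distribˡ-* _ _ ⟩
    (- ⟦ pos (suc m) ⟧) * ⟦ j ⟧    ∎

  homomorphism : ℤ.+-*-rawRing -Raw-AlmostCommutative⟶ fromCommutativeRing ring
  homomorphism = record
    { ⟦_⟧    = ⟦_⟧
    ; +-homo = ⟦⟧-+
    ; *-homo = ⟦⟧-*
    ; -‿homo = ⟦⟧-neg
    ; 0-homo = refl
    ; 1-homo = +-identityʳ 1#
    }

  open Algebra.Solver.Ring ℤ.+-*-rawRing (fromCommutativeRing ring) homomorphism
    (λ i j → map (cong ⟦_⟧) (dec⇒weaklyDec ℤ._≟_ i j)) public
    using (solve; _:=_; _:+_; _:*_; :-_)

-- Weighted sums over chosen positions of a list.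

module WeightedSums
  {A : Set} {_+_ _*_ : A → A → A} { -_ : A → A} {0# 1# : A}
  (isCommutativeRing : IsCommutativeRing _≡_ _+_ _*_ -_ 0# 1#)
  (Weight : A → Set)
  where

  open IsCommutativeRing isCommutativeRing using (+-assoc; +-comm; +-identityˡ; *-comm; distribˡ; zeroʳ)

  -- WeightedSum l k s t: some k positions of l carry weights with total t
  -- for which the weighted sum of the entries is s.
  data WeightedSum : List A → ℕ → A → A → Set where
    none : WeightedSum [] 0 0# 0#
    drop : ∀ {x l k s t} → WeightedSum l k s t → WeightedSum (x ∷ l) k s t
    pick : ∀ {x l k s t a} → Weight a → WeightedSum l k s t →
           WeightedSum (x ∷ l) (suc k) ((a * x) + s) (a + t)

  exchange : ∀ x y z → x + (y + z) ≡ y + (x + z)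
  exchange x y z = trans (sym (+-assoc x y z)) (trans (cong (_+ z) (+-comm x y)) (+-assoc y x z))

  -- Weights travel with their entries, so only a swap of two picked entries changes the form of the
  -- sums. This allows equal entries to be brought together before weights are chosen.
  permute : ∀ {l l′ k s t} → l ↭ l′ → WeightedSum l k s t → WeightedSum l′ k s t
  permute Perm.refl w = w
  permute (prep x p) (drop w) = drop (permute p w)
  permute (prep x p) (pick a w) = pick a (permute p w)
  permute (swap x y p) (drop (drop w)) = drop (drop (permute p w))
  permute (swap x y p) (drop (pick b w)) = pick b (drop (permute p w))
  permute (swap x y p) (pick a (drop w)) = drop (pick a (permute p w))
  permute (swap x y p) (pick a (pick b w)) =
    subst₂ (WeightedSum _ _) (exchange _ _ _) (exchange _ _ _) (pick b (pick a (permute p w)))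
  permute (Perm.trans p q) w = permute q (permute p w)

  dropAll : ∀ l → WeightedSum l 0 0# 0#
  dropAll []      = none
  dropAll (_ ∷ l) = drop (dropAll l)

  append : ∀ {l l′ k k′ s s′ t t′} → WeightedSum l k s t → WeightedSum l′ k′ s′ t′ →
           WeightedSum (l ++ l′) (k ℕ.+ k′) (s + s′) (t + t′)
  append none       w′ = subst₂ (WeightedSum _ _) (sym (+-identityˡ _)) (sym (+-identityˡ _)) w′
  append (drop w)   w′ = drop (append w w′)
  append (pick a w) w′ = subst₂ (WeightedSum _ _) (sym (+-assoc _ _ _)) (sym (+-assoc _ _ _)) (pick a (append w w′))

  size≤length : ∀ {l k s t} → WeightedSum l k s t → k ℕ.≤ length l
  size≤length none       = ℕ.z≤n
  size≤length (drop w)   = ℕ.m≤n⇒m≤1+n (size≤length w)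
  size≤length (pick _ w) = ℕ.s≤s (size≤length w)

  -- Since `x` factors out, a choice among copies of `x` is governed by its total weight alone.
  replicate-sum : ∀ m x {k s t} → WeightedSum (List.replicate m x) k s t → s ≡ (x * t)
  replicate-sum zero    x none = sym (zeroʳ x)
  replicate-sum (suc m) x (drop w) = replicate-sum m x w
  replicate-sum (suc m) x (pick {s = s} {t = t} {a = a} _ w) =
    trans (cong₂ _+_ (*-comm a x) (replicate-sum m x w)) (sym (distribˡ x a t))

-- Products and squares in a field.

module Fields
  {A : Set} {_+_ _*_ : A → A → A} { -_ : A → A} {0# 1# : A}
  (isCommutativeRing : IsCommutativeRing _≡_ _+_ _*_ -_ 0# 1#)
  (inverse : ∀ x → x ≢ 0# → ∃[ y ] x * y ≡ 1#)
  where

  open IsCommutativeRing isCommutativeRing using (*-identityˡ; *-assoc; *-comm; zeroʳ; -‿inverseʳ)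
  open IntegerCoefficients isCommutativeRing using (ring; solve; _:=_; _:+_; _:*_; :-_)
  open import Algebra.Properties.Group (CommutativeRing.+-group ring) using (x∙y⁻¹≈ε⇒x≈y)
  open ≡-Reasoning

  divide : ∀ {w c q} w′ → w * w′ ≡ 1# → w * q ≡ c → q ≡ w′ * c
  divide {w} {c} {q} w′ ww′≡1 wq≡c = begin
    q              ≡⟨ *-identityˡ q ⟨
    1# * q         ≡⟨ cong (_* q) (trans (*-comm w′ w) ww′≡1) ⟨
    (w′ * w) * q   ≡⟨ *-assoc w′ w q ⟩
    w′ * (w * q)   ≡⟨ cong (w′ *_) wq≡c ⟩
    w′ * c         ∎

  *-≢0 : ∀ {x y} → x ≢ 0# → y ≢ 0# → (x * y) ≢ 0#
  *-≢0 {x} x≢0 y≢0 xy≡0 with x′ , xx′≡1 ← inverse x x≢0 =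
    y≢0 (trans (divide x′ xx′≡1 xy≡0) (zeroʳ x′))

  -- The difference of the two sides is `u (x - y) (x + y)`, a product of nonzero factors.
  squares-≢ : ∀ {u x y} → u ≢ 0# → x ≢ y → (x + y) ≢ 0# → (u * (x * x)) ≢ (u * (y * y))
  squares-≢ {u} {x} {y} u≢0 x≢y x+y≢0 e =
    *-≢0 u≢0 (*-≢0 (λ e → x≢y (x∙y⁻¹≈ε⇒x≈y x y e)) x+y≢0) (begin
      u * ((x + (- y)) * (x + y))          ≡⟨ factor u x y ⟩
      (u * (x * x)) + (- (u * (y * y)))    ≡⟨ cong (_+ (- (u * (y * y)))) e ⟩
      (u * (y * y)) + (- (u * (y * y)))    ≡⟨ -‿inverseʳ _ ⟩
      0#                                   ∎)
    where
    factor : ∀ u x y → u * ((x + (- y)) * (x + y)) ≡ (u * (x * x)) + (- (u * (y * y)))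
    factor = solve 3 (λ u x y → u :* ((x :+ :- y) :* (x :+ y)) := u :* (x :* x) :+ :- (u :* (y :* y))) refl

-- What the upper bound uses about ℤ/pℤ. The field `avoid` is where 3 and 5 drop out, having at most
-- two nonzero squares. Solutions of `conic` may have zero coordinates, which `perturb` and
-- `two-cover` deal with.
record LargeField : Set₁ where
  infixl 6 _+_
  infixl 7 _*_
  infix  8 -_
  infix  4 _≟_
  field
    Carrier : Set
    _+_ _*_ : Carrier → Carrier → Carrier
    -_      : Carrier → Carrier
    0# 1#   : Carrier
    isCommutativeRing : IsCommutativeRing _≡_ _+_ _*_ -_ 0# 1#
    _≟_     : DecidableEquality Carrier
    inverse : ∀ x → x ≢ 0# → ∃[ y ] x * y ≡ 1#
    1+1≢0   : 1# + 1# ≢ 0#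
    avoid   : ∀ c d → ∃[ x ] x ≢ 0# × x * x ≢ c × x * x ≢ d
    conic   : ∀ {u v} c → u ≢ 0# → v ≢ 0# → ∃₂ λ x y → u * (x * x) + v * (y * y) ≡ c

-- Representing field elements by diagonal forms in nonzero squares.

module Covering (F : LargeField) where
  open LargeField F
  open IsCommutativeRing isCommutativeRing
    using (+-comm; +-assoc; +-identityˡ; +-identityʳ; *-identityˡ; *-identityʳ; zeroˡ; zeroʳ; distribʳ)
  open Fields isCommutativeRing inverse public using (*-≢0; divide)
  open IntegerCoefficients isCommutativeRing using (ring; solve; _:=_; _:+_; _:*_; :-_)
  open import Algebra.Properties.Group (CommutativeRing.+-group ring)
    using (inverseʳ-unique; x∙y⁻¹≈ε⇒x≈y; //-rightDividesˡ)
  open ≡-Reasoning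

  x+x≢0 : ∀ {x} → x ≢ 0# → x + x ≢ 0#
  x+x≢0 {x} x≢0 x+x≡0 = *-≢0 1+1≢0 x≢0 (begin
    (1# + 1#) * x      ≡⟨ distribʳ x 1# 1# ⟩
    1# * x + 1# * x    ≡⟨ cong₂ _+_ (*-identityˡ x) (*-identityˡ x) ⟩
    x + x              ≡⟨ x+x≡0 ⟩
    0#                 ∎)

  -- Spelled like `Q`, so that for residues the two agree definitionally and selections found here
  -- have weights in `Q`.
  Square : Carrier → Set
  Square a = ∃[ x ] (∃[ y ] x * y ≡ 1#) × a ≡ x * x

  square : ∀ {x} → x ≢ 0# → Square (x * x)
  square {x} x≢0 = x , inverse x x≢0 , refl

  avoid-scaled : ∀ {v w} c d → v ≢ 0# → w ≢ 0# → ∃[ x ] x ≢ 0# × v * (x * x) ≢ c × w * (x * x) ≢ d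
  avoid-scaled {v} {w} c d v≢0 w≢0
    with v′ , vv′≡1 ← inverse v v≢0 | w′ , ww′≡1 ← inverse w w≢0
    with x , x≢0 , x²≢ , x²≢′ ← avoid (v′ * c) (w′ * d) =
    x , x≢0 , (λ e → x²≢ (divide v′ vv′≡1 e)) , (λ e → x²≢′ (divide w′ ww′≡1 e))

  -- Opaque, so that with-abstraction does not normalise the solver's proofs.
  opaque
    conic-identity : ∀ u w x t r s → s ≡ u + w * (t * t) →
      let X = (u + - (w * (t * t))) * (x * r) ; Y = u * (t + t) * (x * r) in
      u * (X * X) + w * (Y * Y) ≡ u * (x * x) * ((s * r) * (s * r))
    conic-identity u w x t r s refl = begin
      -- The core is `(u - m)² + 4 u m = (u + m)²` with `m = w t²`. In `perturb`, `r` is the inverse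
      -- of `s`, so the right side becomes `u x²`.
      u * ((d * z) * (d * z)) + w * ((u * (t + t) * z) * (u * (t + t) * z))  ≡⟨ factor u w d (t + t) z ⟩
      u * (z * z) * (d * d + u * (w * ((t + t) * (t + t))))                  ≡⟨ cong (λ e → u * (z * z) * (d * d + u * e)) (quadruple w t) ⟩
      u * (z * z) * (d * d + u * ((m + m) + (m + m)))                        ≡⟨ cong (u * (z * z) *_) (difference u m) ⟩
      u * (z * z) * (s * s)                                                  ≡⟨ regroup u x r s ⟩
      u * (x * x) * ((s * r) * (s * r))                                      ∎
      where
      m d z : Carrier
      m = w * (t * t)
      d = u + - m
      z = x * r

      factor : ∀ u w d e z → u * ((d * z) * (d * z)) + w * ((u * e * z) * (u * e * z)) ≡
               u * (z * z) * (d * d + u * (w * (e * e)))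
      factor = solve 5 (λ u w d e z → u :* ((d :* z) :* (d :* z)) :+ w :* ((u :* e :* z) :* (u :* e :* z)) :=
                          u :* (z :* z) :* (d :* d :+ u :* (w :* (e :* e)))) refl

      quadruple : ∀ w t → let m = w * (t * t) in w * ((t + t) * (t + t)) ≡ (m + m) + (m + m)
      quadruple = solve 2 (λ w t → let m = w :* (t :* t) in
                             w :* ((t :+ t) :* (t :+ t)) := (m :+ m) :+ (m :+ m)) refl

      difference : ∀ u m → (u + - m) * (u + - m) + u * ((m + m) + (m + m)) ≡ (u + m) * (u + m)
      difference = solve 2 (λ u m → (u :+ :- m) :* (u :+ :- m) :+ u :* ((m :+ m) :+ (m :+ m)) :=
                              (u :+ m) :* (u :+ m)) refl

      regroup : ∀ u x r s → u * ((x * r) * (x * r)) * (s * s) ≡ u * (x * x) * ((s * r) * (s * r))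
      regroup = solve 4 (λ u x r s → u :* ((x :* r) :* (x :* r)) :* (s :* s) :=
                           u :* (x :* x) :* ((s :* r) :* (s :* r))) refl

  -- The conic u X² + w Y² = u x² is parametrised by the lines through (- x, 0);
  -- the point with parameter t ≠ 0 has nonzero coordinates unless w t² = ± u.
  perturb : ∀ {u w x} → u ≢ 0# → w ≢ 0# → x ≢ 0# →
            ∃₂ λ a b → Square a × Square b × u * a + w * b ≡ u * (x * x)
  perturb {u} {w} {x} u≢0 w≢0 x≢0
    -- The first exclusion makes `X` nonzero; the second makes the common denominator `u + w t²`
    -- invertible.
    with t , t≢0 , wt²≢u , wt²≢-u ← avoid-scaled u (- u) w≢0 w≢0
    with r , sr≡1 ← inverse (u + w * (t * t)) (λ e → wt²≢-u (inverseʳ-unique _ _ e)) =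
    X * X , Y * Y , square X≢0 , square Y≢0 , (begin
      u * (X * X) + w * (Y * Y)          ≡⟨ conic-identity u w x t r s refl ⟩
      u * (x * x) * ((s * r) * (s * r))  ≡⟨ cong (λ e → u * (x * x) * (e * e)) sr≡1 ⟩
      u * (x * x) * (1# * 1#)            ≡⟨ cong (u * (x * x) *_) (*-identityˡ 1#) ⟩
      u * (x * x) * 1#                   ≡⟨ *-identityʳ _ ⟩
      u * (x * x)                        ∎)
    where
    s X Y : Carrier
    s = u + w * (t * t)
    X = (u + - (w * (t * t))) * (x * r)
    Y = u * (t + t) * (x * r)

    r≢0 : r ≢ 0#
    -- If `r` vanished, then `1#` would be zero, and with it `1# + 1#`.
    r≢0 r≡0 = 1+1≢0 (begin
      1# + 1#         ≡⟨ cong₂ _+_ sr≡1 sr≡1 ⟨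
      s * r + s * r   ≡⟨ cong (λ r → s * r + s * r) r≡0 ⟩
      s * 0# + s * 0# ≡⟨ cong₂ _+_ (zeroʳ s) (zeroʳ s) ⟩
      0# + 0#         ≡⟨ +-identityˡ 0# ⟩
      0#              ∎)

    X≢0 : X ≢ 0#
    X≢0 = *-≢0 (λ e → wt²≢u (sym (x∙y⁻¹≈ε⇒x≈y _ _ e))) (*-≢0 x≢0 r≢0)

    Y≢0 : Y ≢ 0#
    Y≢0 = *-≢0 (*-≢0 u≢0 (x+x≢0 t≢0)) (*-≢0 x≢0 r≢0)

  -- A point of the conic with both coordinates nonzero serves directly. If one coordinate vanishes,
  -- `perturb` moves the point while keeping the value; if both do, `c` would be zero.
  two-cover : ∀ {u v c} → u ≢ 0# → v ≢ 0# → c ≢ 0# →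
              ∃₂ λ a b → Square a × Square b × u * a + v * b ≡ c
  two-cover {u} {v} {c} u≢0 v≢0 c≢0 with conic c u≢0 v≢0
  ... | x , y , e with x ≟ 0# | y ≟ 0#
  ... | no x≢0   | no y≢0   = x * x , y * y , square x≢0 , square y≢0 , e
  ... | yes refl | yes refl = contradiction (begin
      c                                    ≡⟨ e ⟨
      u * (0# * 0#) + v * (0# * 0#)        ≡⟨ cong (λ z → u * z + v * z) (zeroˡ 0#) ⟩
      u * 0# + v * 0#                      ≡⟨ cong₂ _+_ (zeroʳ u) (zeroʳ v) ⟩
      0# + 0#                              ≡⟨ +-identityˡ 0# ⟩
      0#                                   ∎) c≢0
  ... | no x≢0   | yes refl with a , b , Qa , Qb , e′ ← perturb u≢0 v≢0 x≢0 =
    a , b , Qa , Qb , (begin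
      u * a + v * b                        ≡⟨ e′ ⟩
      u * (x * x)                          ≡⟨ +-identityʳ _ ⟨
      u * (x * x) + 0#                     ≡⟨ cong (u * (x * x) +_) (zeroʳ v) ⟨
      u * (x * x) + v * 0#                 ≡⟨ cong (λ z → u * (x * x) + v * z) (zeroˡ 0#) ⟨
      u * (x * x) + v * (0# * 0#)          ≡⟨ e ⟩
      c                                    ∎)
  ... | yes refl | no y≢0   with b , a , Qb , Qa , e′ ← perturb v≢0 u≢0 y≢0 =
    a , b , Qa , Qb , (begin
      u * a + v * b                        ≡⟨ +-comm _ _ ⟩
      v * b + u * a                        ≡⟨ e′ ⟩
      v * (y * y)                          ≡⟨ +-identityˡ _ ⟨
      0# + v * (y * y)                     ≡⟨ cong (_+ v * (y * y)) (zeroʳ u) ⟨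
      u * 0# + v * (y * y)                 ≡⟨ cong (λ z → u * z + v * (y * y)) (zeroˡ 0#) ⟨
      u * (0# * 0#) + v * (y * y)          ≡⟨ e ⟩
      c                                    ∎)

  -- The third weight is spent on making the remaining target nonzero, as `two-cover` requires.
  three-cover : ∀ {u v w} c → u ≢ 0# → v ≢ 0# → w ≢ 0# →
                ∃[ a ] ∃[ b ] ∃[ d ] Square a × Square b × Square d × u * a + (v * b + w * d) ≡ c
  three-cover {u} {v} {w} c u≢0 v≢0 w≢0
    with z , z≢0 , wz²≢c , _ ← avoid-scaled c c w≢0 w≢0
    with a , b , Qa , Qb , e ← two-cover {c = c + - (w * (z * z))} u≢0 v≢0 (λ e → wz²≢c (sym (x∙y⁻¹≈ε⇒x≈y _ _ e))) =
    a , b , z * z , Qa , Qb , square z≢0 , (begin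
      u * a + (v * b + w * (z * z))        ≡⟨ +-assoc _ _ _ ⟨
      (u * a + v * b) + w * (z * z)        ≡⟨ cong (_+ w * (z * z)) e ⟩
      (c + - (w * (z * z))) + w * (z * z)  ≡⟨ //-rightDividesˡ (w * (z * z)) c ⟩
      c                                    ∎)

-- Zero-sum selections over a large field.

module Selection (F : LargeField) where
  open LargeField F
  open Covering F
  open IsCommutativeRing isCommutativeRing
    using (+-comm; +-assoc; +-identityˡ; +-identityʳ; *-identityˡ; *-identityʳ; zeroˡ; zeroʳ; -‿inverseʳ)
  open WeightedSums isCommutativeRing Square public
  open IntegerCoefficients isCommutativeRing using (ring; solve; _:=_; _:+_; _:*_; :-_)
  open import Algebra.Properties.Group (CommutativeRing.+-group ring)
    using (x∙y⁻¹≈ε⇒x≈y; //-rightDividesˡ)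
  open ≡-Reasoning

  1≢0 : 1# ≢ 0#
  1≢0 1≡0 = 1+1≢0 (trans (cong₂ _+_ 1≡0 1≡0) (+-identityˡ 0#))

  square-1 : Square 1#
  square-1 = 1# , (1# , *-identityˡ 1#) , sym (*-identityˡ 1#)

  -- Filler: these entries receive weight `1#`, and their contribution is compensated by the weights
  -- of other entries.
  some : ∀ l {k} → k ≤ length l → ∃₂ λ s t → WeightedSum l k s t
  some l       {zero}  _       = 0# , 0# , dropAll l
  some (x ∷ l) {suc k} (s≤s h) with s , t , w ← some l h = _ , _ , pick square-1 w

  opaque
    linear-pick : ∀ α β a y s t → α * (a * y + s) + β * (a + t) ≡ (α * y + β) * a + (α * s + β * t)
    linear-pick = solve 6 (λ α β a y s t → α :* (a :* y :+ s) :+ β :* (a :+ t) :=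
                    (α :* y :+ β) :* a :+ (α :* s :+ β :* t)) refl

  -- By `linear-pick`, an entry `y` of weight `a` contributes `(α y + β) a` to the functional. The
  -- first three entries therefore reach any target by `three-cover`, after the rest has been given
  -- arbitrary weights.
  linear-cover : ∀ α β c {l k} → All (λ y → α * y + β ≢ 0#) l → 3 ≤ k → k ≤ length l →
                 ∃₂ λ s t → WeightedSum l k s t × α * s + β * t ≡ c
  linear-cover α β c {y₁ ∷ y₂ ∷ y₃ ∷ l} (h₁ ∷ h₂ ∷ h₃ ∷ _) (s≤s (s≤s (s≤s _))) (s≤s (s≤s (s≤s k≤)))
    with s , t , w ← some l k≤
    with a , b , d , Qa , Qb , Qd , e ← three-cover (c + - (α * s + β * t)) h₁ h₂ h₃ =
    _ , _ , pick Qa (pick Qb (pick Qd w)) , (begin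
      α * (a * y₁ + (b * y₂ + (d * y₃ + s))) + β * (a + (b + (d + t)))
        ≡⟨ linear-pick α β a y₁ _ _ ⟩
      u₁ * a + (α * (b * y₂ + (d * y₃ + s)) + β * (b + (d + t)))
        ≡⟨ cong (u₁ * a +_) (linear-pick α β b y₂ _ _) ⟩
      u₁ * a + (u₂ * b + (α * (d * y₃ + s) + β * (d + t)))
        ≡⟨ cong (λ e → u₁ * a + (u₂ * b + e)) (linear-pick α β d y₃ s t) ⟩
      u₁ * a + (u₂ * b + (u₃ * d + r))
        ≡⟨ cong (u₁ * a +_) (+-assoc _ _ _) ⟨
      u₁ * a + ((u₂ * b + u₃ * d) + r)
        ≡⟨ +-assoc _ _ _ ⟨
      (u₁ * a + (u₂ * b + u₃ * d)) + r
        ≡⟨ cong (_+ r) e ⟩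
      (c + - r) + r
        ≡⟨ //-rightDividesˡ r c ⟩
      c ∎)
    where
    u₁ u₂ u₃ r : Carrier
    u₁ = α * y₁ + β
    u₂ = α * y₂ + β
    u₃ = α * y₃ + β
    r = α * s + β * t

  -- For `α = 0` and `β = 1` the functional of `linear-cover` is the total weight, and
  -- `replicate-sum` then determines the weighted sum.
  replicate-cover : ∀ {m k} x t → 3 ≤ k → k ≤ m → WeightedSum (replicate m x) k (x * t) t
  replicate-cover {m} {k} x t 3≤k k≤m
    with s′ , t′ , w , e ← linear-cover 0# 1# t
           (replicate⁺ m λ 0x+1≡0 → 1≢0 (trans (sym (trans (cong (_+ 1#) (zeroˡ x)) (+-identityˡ 1#))) 0x+1≡0))
           3≤k (subst (k ≤_) (sym (List.length-replicate m)) k≤m)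
    = subst₂ (WeightedSum _ _) (trans (replicate-sum m x w) (cong (x *_) t′≡t)) t′≡t w
    where
    t′≡t : t′ ≡ t
    t′≡t = begin
      t′                  ≡⟨ *-identityˡ t′ ⟨
      1# * t′             ≡⟨ +-identityˡ _ ⟨
      0# + 1# * t′        ≡⟨ cong (_+ 1# * t′) (zeroˡ s′) ⟨
      0# * s′ + 1# * t′   ≡⟨ e ⟩
      t                   ∎

  -- i copies of x take part; the functional y ↦ y - x kills them, so the
  -- remaining entries are made to vanish under it first.
  split-zero-sum : ∀ {m r k} x i j → i ℕ.+ j ≡ k → All (_≢ x) r →
                   3 ≤ i → i ≤ m → 3 ≤ j → j ≤ length r →
                   WeightedSum (replicate m x ++ r) k 0# 0#
  split-zero-sum {m} {r} x i j refl r≢x 3≤i i≤m 3≤j j≤r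
    with s , t , w , e ← linear-cover 1# (- x) 0#
           (All.map (λ y≢x e → y≢x (trans (sym (*-identityˡ _)) (x∙y⁻¹≈ε⇒x≈y _ _ e))) r≢x) 3≤j j≤r
    -- The other entries satisfy `s = x t`, so copies of `x` of total weight `- t` cancel both sums
    -- at once.
    = subst₂ (WeightedSum _ _) s-sum (trans (+-comm (- t) t) (-‿inverseʳ t))
        (append (replicate-cover x (- t) 3≤i i≤m) w)
    where
    s-sum : x * (- t) + s ≡ 0#
    s-sum = begin
      x * (- t) + s       ≡⟨ solve 3 (λ x t s → x :* (:- t) :+ s := s :+ (:- x) :* t) refl x t s ⟩
      s + - x * t         ≡⟨ cong (_+ - x * t) (*-identityˡ s) ⟨
      1# * s + - x * t    ≡⟨ e ⟩
      0#                  ∎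

  -- If there are `k` copies of `x`, they suffice alone. Otherwise the choice is split so that both
  -- the copies and the other entries number at least three, as `linear-cover` demands: all `m`
  -- copies when `m + 3 ≤ k`, and `k - 3` copies when not.
  triple-zero-sum : ∀ {m r k} x → All (_≢ x) r → 3 ≤ m → 6 ≤ k → m ℕ.+ length r ≡ k ℕ.+ 2 →
                    WeightedSum (replicate m x ++ r) k 0# 0#
  triple-zero-sum {m} {r} {k} x r≢x 3≤m 6≤k m+r≡k+2 with k ℕ.≤? m | m ℕ.+ 3 ℕ.≤? k
  ... | yes k≤m | _ =
    subst₂ (WeightedSum _ k) (trans (+-identityʳ _) (zeroʳ x)) (+-identityˡ 0#)
      (subst (λ k → WeightedSum _ k _ _) (ℕ.+-identityʳ k)
        (append (replicate-cover x 0# 3≤k k≤m) (dropAll r)))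
    where
    3≤k : 3 ≤ k
    3≤k = ℕ.≤-trans (ℕ.m≤m+n 3 3) 6≤k
  ... | no k≰m | yes m+3≤k with j , refl ← ℕ.m≤n⇒∃[o]m+o≡n (ℕ.≤-trans (ℕ.m≤m+n m 3) m+3≤k) =
    split-zero-sum x m j refl r≢x 3≤m ℕ.≤-refl (ℕ.+-cancelˡ-≤ m 3 j m+3≤k)
      (ℕ.+-cancelˡ-≤ m j (length r) (subst (m ℕ.+ j ≤_) (sym m+r≡k+2) (ℕ.m≤m+n (m ℕ.+ j) 2)))
  -- Since `m < k`, there are `k + 2 - m ≥ 3` entries other than `x`, and `6 ≤ k` leaves at least
  -- three copies of `x`.
  ... | no k≰m | no m+3≰k with i , refl ← ℕ.m≤n⇒∃[o]m+o≡n (ℕ.≤-trans (ℕ.m≤m+n 3 3) 6≤k) =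
    split-zero-sum x i 3 (ℕ.+-comm i 3) r≢x (ℕ.+-cancelˡ-≤ 3 3 i 6≤k)
      (ℕ.+-cancelʳ-≤ 3 i m (subst (_≤ m ℕ.+ 3) (ℕ.+-comm 3 i) (ℕ.<⇒≤ (ℕ.≰⇒> m+3≰k))))
      ℕ.≤-refl
      (ℕ.+-cancelˡ-≤ m 3 (length r) (subst₂ _≤_ (sym (ℕ.+-suc m 2)) (sym m+r≡k+2)
        (ℕ.+-monoˡ-≤ 2 (ℕ.≰⇒> k≰m))))

  -- This is `two-cover` with both coefficients `1#`. Total zero is excluded because it would make
  -- `- 1#` a square.
  pair-cover : ∀ x {c} → c ≢ 0# → WeightedSum (x ∷ x ∷ []) 2 (x * c) c
  pair-cover x {c} c≢0 with a , b , Qa , Qb , e ← two-cover 1≢0 1≢0 c≢0 =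
    subst₂ (WeightedSum _ _) (trans s≡ (cong (x *_) c≡)) c≡ (pick Qa (pick Qb none))
    where
    s≡ : a * x + (b * x + 0#) ≡ x * (a + (b + 0#))
    s≡ = replicate-sum 2 x (pick Qa (pick Qb none))

    c≡ : a + (b + 0#) ≡ c
    c≡ = begin
      a + (b + 0#)      ≡⟨ cong (a +_) (+-identityʳ b) ⟩
      a + b             ≡⟨ cong₂ _+_ (*-identityˡ a) (*-identityˡ b) ⟨
      1# * a + 1# * b   ≡⟨ e ⟩
      c                 ∎

  opaque
    -- The form `s - x t` vanishes exactly on the multiples of `(x, 1)`. Separating its dependence
    -- on the weight `q` of `z` shows which single value of `(z - x) q` is to be avoided.
    defect : ∀ x z q s t → (q * z + s) + - (x * (q + t)) ≡ (z + - x) * q + - (x * t + - s)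
    defect = solve 5 (λ x z q s t → (q :* z :+ s) :+ :- (x :* (q :+ t)) :=
               (z :+ :- x) :* q :+ :- (x :* t :+ :- s)) refl

    -- Cramer's rule: with `D` inverse to `y - x`, the two coefficients are the coordinates of
    -- `- (s, t)` in the basis `(x, 1)`, `(y, 1)`. This identity checks the second component and
    -- `cramer-sum` the first.
    cramer-total : ∀ x y D s t → (s + - (y * t)) * D + (- (s + - (x * t)) * D + t) ≡ t + - (t * ((y + - x) * D))
    cramer-total = solve 5 (λ x y D s t →
      (s :+ :- (y :* t)) :* D :+ ((:- (s :+ :- (x :* t))) :* D :+ t) :=
      t :+ :- (t :* ((y :+ :- x) :* D))) refl

    cramer-sum : ∀ x y D s t →
      x * ((s + - (y * t)) * D) + (y * (- (s + - (x * t)) * D) + s) ≡ s + - (s * ((y + - x) * D))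
    cramer-sum = solve 5 (λ x y D s t →
      x :* ((s :+ :- (y :* t)) :* D) :+ (y :* ((:- (s :+ :- (x :* t))) :* D) :+ s) :=
      s :+ :- (s :* ((y :+ :- x) :* D))) refl

  -- The pairs contribute every c (x, 1) + d (y, 1) with c, d ≠ 0, so it
  -- suffices to keep the contribution of the rest off the lines spanned by
  -- (x, 1) and (y, 1), which the weight of z achieves.
  pairs-zero-sum : ∀ {x y z l k} → x ≢ y → z ≢ x → z ≢ y → k ≤ length l →
                   WeightedSum (x ∷ x ∷ y ∷ y ∷ z ∷ l) (5 ℕ.+ k) 0# 0#
  pairs-zero-sum {x} {y} {z} {l} {k} x≢y z≢x z≢y k≤l
    with S , T , w ← some l k≤l
    with v , v≢0 , off-x , off-y ← avoid-scaled (x * T + - S) (y * T + - S)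
           (λ e → z≢x (x∙y⁻¹≈ε⇒x≈y _ _ e)) (λ e → z≢y (x∙y⁻¹≈ε⇒x≈y _ _ e))
    with D , unit ← inverse (y + - x) (λ e → x≢y (sym (x∙y⁻¹≈ε⇒x≈y _ _ e))) =
    subst₂ (WeightedSum _ _)
      (trans (cramer-sum x y D s t) (vanish s)) (trans (cramer-total x y D s t) (vanish t))
      -- The coefficient for `x` vanishes only on the line of `(y, 1)`, and the coefficient for `y`
      -- only on that of `(x, 1)`.
      (append (pair-cover x (*-≢0 (s-yt≢0) D≢0))
        (append (pair-cover y (*-≢0 -[s-xt]≢0 D≢0))
          (pick (square v≢0) w)))
    where
    q s t : Carrier
    q = v * v
    s = q * z + S
    t = q + T

    vanish : ∀ a → a + - (a * ((y + - x) * D)) ≡ 0#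
    vanish a = begin
      a + - (a * ((y + - x) * D))  ≡⟨ cong (λ u → a + - (a * u)) unit ⟩
      a + - (a * 1#)               ≡⟨ cong (λ b → a + - b) (*-identityʳ a) ⟩
      a + - a                      ≡⟨ -‿inverseʳ a ⟩
      0#                           ∎

    D≢0 : D ≢ 0#
    D≢0 D≡0 = 1≢0 (trans (sym unit) (trans (cong ((y + - x) *_) D≡0) (zeroʳ _)))

    s-yt≢0 : s + - (y * t) ≢ 0#
    s-yt≢0 e = off-y (x∙y⁻¹≈ε⇒x≈y _ _ (trans (sym (defect y z q S T)) e))

    -[s-xt]≢0 : - (s + - (x * t)) ≢ 0#
    -[s-xt]≢0 e = off-x (x∙y⁻¹≈ε⇒x≈y _ _ (trans (sym (defect x z q S T))
      (begin
        s + - (x * t)                              ≡⟨ +-identityʳ _ ⟨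
        (s + - (x * t)) + 0#                       ≡⟨ cong ((s + - (x * t)) +_) e ⟨
        (s + - (x * t)) + - (s + - (x * t))        ≡⟨ -‿inverseʳ _ ⟩
        0#                                         ∎)))

-- Repeated entries in long lists over a small set.

module Multiplicity {A : Set} (_≟_ : DecidableEquality A) where
  open DecMembership _≟_ using (_∈?_)

  ∈⇒↭∷ : ∀ {x : A} {l} → x ∈ l → ∃[ l′ ] l ↭ x ∷ l′
  ∈⇒↭∷ x∈l with ys , zs , refl ← ∈-∃++ x∈l = ys ++ zs , shift _ ys zs

  unique-or-repeated : ∀ l → Unique l ⊎ ∃₂ λ (x : A) l′ → l ↭ x ∷ x ∷ l′
  unique-or-repeated [] = inj₁ []
  unique-or-repeated (x ∷ l) with x ∈? l
  ... | yes x∈l with l′ , p ← ∈⇒↭∷ x∈l = inj₂ (x , l′ , prep x p)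
  ... | no x∉l with unique-or-repeated l
  ...   | inj₁ u = inj₁ (¬Any⇒All¬ l x∉l ∷ u)
  ...   | inj₂ (y , l′ , p) =
    inj₂ (y , x ∷ l′ , ↭-trans (prep x p) (↭-sym (shift x (y ∷ y ∷ []) l′)))

  gather : ∀ (x : A) l → ∃₂ λ m r → All (_≢ x) r × l ↭ replicate m x ++ r
  gather x [] = 0 , [] , [] , ↭-refl
  gather x (y ∷ l) with m , r , r≢x , p ← gather x l | y ≟ x
  ... | yes refl = suc m , r , r≢x , prep x p
  ... | no y≢x   = m , y ∷ r , y≢x ∷ r≢x ,
    ↭-trans (prep y p) (↭-sym (shift y (replicate m x) r))

  module _ {n} (bounded : ∀ {l : List A} → Unique l → length l ≤ n) where

    -- Set aside a repeated `x`; at least `n` entries remain. If `x` is not among them, they cannot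
    -- be distinct, for together with `x` they would give more than `n` values. So some `y` repeats,
    -- and `3 ≤ n` provides a further entry `z`, which either differs from `y` or completes a
    -- triple.
    triple-or-two-pairs : ∀ l → n ℕ.+ 2 ≤ length l → 3 ≤ n →
      (∃₂ λ (x : A) l′ → l ↭ x ∷ x ∷ x ∷ l′) ⊎
      (∃[ x ] ∃[ y ] ∃[ z ] ∃[ l′ ] x ≢ y × z ≢ x × z ≢ y × l ↭ x ∷ x ∷ y ∷ y ∷ z ∷ l′)
    triple-or-two-pairs l n+2≤l 3≤n with unique-or-repeated l
    ... | inj₁ u = contradiction (ℕ.≤-trans n+2≤l (bounded u)) (ℕ.m+1+n≰m n)
    ... | inj₂ (x , l₁ , p) with x ∈? l₁
    ...   | yes x∈l₁ with l₂ , q ← ∈⇒↭∷ x∈l₁ = inj₁ (x , l₂ , ↭-trans p (prep x (prep x q)))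
    ...   | no x∉l₁ with n≤l₁ ← ℕ.+-cancelʳ-≤ 2 n (length l₁)
                       (subst (n ℕ.+ 2 ≤_) (trans (↭-length p) (ℕ.+-comm 2 _)) n+2≤l)
                    with unique-or-repeated l₁
    ...     | inj₁ u = contradiction (bounded (¬Any⇒All¬ l₁ x∉l₁ ∷ u)) (ℕ.≤⇒≯ n≤l₁)
    ...     | inj₂ (y , [] , q) =
      contradiction (ℕ.≤-trans 3≤n (subst (n ≤_) (↭-length q) n≤l₁)) λ { (s≤s (s≤s ())) }
    ...     | inj₂ (y , z ∷ l₂ , q) with z ≟ y
    ...       | yes refl = inj₁ (y , x ∷ x ∷ l₂ , ↭-trans p (↭-trans (prep x (prep x q))
                  (↭-trans (prep x (↭-sym (shift x (y ∷ y ∷ y ∷ []) l₂)))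
                    (↭-sym (shift x (y ∷ y ∷ y ∷ []) (x ∷ l₂))))))
    ...       | no z≢y = inj₂ (x , y , z , l₂ , x≢ (here refl) , x≢ (there (there (here refl))) ∘ sym , z≢y ,
                  ↭-trans p (prep x (prep x q)))
      where
      x≢ : ∀ {w} → w ∈ y ∷ y ∷ z ∷ l₂ → x ≢ w
      x≢ w∈ refl = x∉l₁ (∈-resp-↭ (↭-sym q) w∈)

lookup-injective : ∀ {A : Set} {l : List A} → Unique l → ∀ {i j} → List.lookup l i ≡ List.lookup l j → i ≡ j
lookup-injective (_ ∷ u) {Fin.zero}  {Fin.zero}  _ = refl
lookup-injective (x≢ ∷ u) {Fin.zero}  {Fin.suc j} e = contradiction e (All.lookup x≢ (∈-lookup j))
lookup-injective (x≢ ∷ u) {Fin.suc i} {Fin.zero}  e = contradiction (sym e) (All.lookup x≢ (∈-lookup i))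
lookup-injective (_ ∷ u) {Fin.suc i} {Fin.suc j} e = cong Fin.suc (lookup-injective u e)

unique-length : ∀ {n} {l : List (Fin n)} → Unique l → length l ≤ n
unique-length u = Fin.injective⇒≤ (lookup-injective u)

import Defs
open Defs using (0#; 1#; Q; sum; E[Q,1]≡; HasWeightedZeroSumSubsequence)

-- Residues modulo n as a commutative ring, and as a field for prime n.

module Residues (n : ℕ) .{{_ : NonZero n}} where
  open Defs using (_+_; _*_)
  open ≡-Reasoning

  residue : ℕ → Fin n
  residue a = a mod n

  toℕ-residue : ∀ a → toℕ (residue a) ≡ a % n
  toℕ-residue a = Fin.toℕ-fromℕ< _

  residue-toℕ : ∀ x → residue (toℕ x) ≡ x
  residue-toℕ x = Fin.toℕ-injective (trans (toℕ-residue (toℕ x)) (ℕ.m<n⇒m%n≡m (Fin.toℕ<n x)))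

  residue-cong : ∀ {a b} → a % n ≡ b % n → residue a ≡ residue b
  residue-cong {a} {b} e = Fin.toℕ-injective (trans (toℕ-residue a) (trans e (sym (toℕ-residue b))))

  residue-+ : ∀ a b → residue a + residue b ≡ residue (a ℕ.+ b)
  residue-+ a b rewrite toℕ-residue a | toℕ-residue b = residue-cong (sym (ℕ.%-distribˡ-+ a b n))

  residue-* : ∀ a b → residue a * residue b ≡ residue (a ℕ.* b)
  residue-* a b rewrite toℕ-residue a | toℕ-residue b = residue-cong (sym (ℕ.%-distribˡ-* a b n))

  residue≡0⇒∣ : ∀ {a} → residue a ≡ 0# → n ∣ a
  residue≡0⇒∣ {a} e = ℕ.m%n≡0⇒n∣m a n (begin
    a % n             ≡⟨ toℕ-residue a ⟨
    toℕ (residue a)   ≡⟨ cong toℕ e ⟩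
    toℕ (residue 0)   ≡⟨ toℕ-residue 0 ⟩
    0 % n             ≡⟨ ℕ.n∣m⇒m%n≡0 0 n (n ℕ.∣0) ⟩
    0                 ∎)

  ∣⇒residue≡0 : ∀ {a} → n ∣ a → residue a ≡ 0#
  ∣⇒residue≡0 {a} n∣a = residue-cong (trans (ℕ.n∣m⇒m%n≡0 a n n∣a) (sym (ℕ.n∣m⇒m%n≡0 0 n (n ℕ.∣0))))

  neg : Fin n → Fin n
  neg x = residue (n ℕ.∸ toℕ x)

  -- Every law is the image of the law for ℕ under the surjection residue.
  isCommutativeRing : IsCommutativeRing _≡_ _+_ _*_ neg 0# 1#
  isCommutativeRing = record
    { isRing = record
      { +-isAbelianGroup = record
        { isGroup = record
          { isMonoid = record
            { isSemigroup = record
              { isMagma = record { isEquivalence = isEquivalence ; ∙-cong = cong₂ _+_ }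
              ; assoc = assoc₊ }
            ; identity = identity₊ , λ x → trans (comm₊ x 0#) (identity₊ x) }
          ; inverse = inverse₊ , λ x → trans (comm₊ x (neg x)) (inverse₊ x)
          ; ⁻¹-cong = cong neg }
        ; comm = comm₊ }
      ; *-cong = cong₂ _*_
      ; *-assoc = assoc*
      ; *-identity = identity* , λ x → trans (comm* x 1#) (identity* x)
      ; distrib = distrib , λ x y z →
          trans (comm* (y + z) x) (trans (distrib x y z) (cong₂ _+_ (comm* x y) (comm* x z)))
      }
    ; *-comm = comm*
    }
    where
    lift₁ : ∀ {P : Fin n → Set} → (∀ a → P (residue a)) → ∀ x → P x
    lift₁ {P} h x = subst P (residue-toℕ x) (h (toℕ x))

    comm₊ : ∀ x y → x + y ≡ y + x
    comm₊ x y = cong residue (ℕ.+-comm (toℕ x) (toℕ y))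

    comm* : ∀ x y → x * y ≡ y * x
    comm* x y = cong residue (ℕ.*-comm (toℕ x) (toℕ y))

    identity₊ : ∀ x → 0# + x ≡ x
    identity₊ = lift₁ λ a → residue-+ 0 a

    identity* : ∀ x → 1# * x ≡ x
    identity* = lift₁ λ a → trans (residue-* 1 a) (cong residue (ℕ.*-identityˡ a))

    inverse₊ : ∀ x → neg x + x ≡ 0#
    inverse₊ x = begin
      neg x + x                              ≡⟨ cong (neg x +_) (residue-toℕ x) ⟨
      neg x + residue (toℕ x)                ≡⟨ residue-+ (n ℕ.∸ toℕ x) (toℕ x) ⟩
      residue (n ℕ.∸ toℕ x ℕ.+ toℕ x)        ≡⟨ cong residue (ℕ.m∸n+n≡m (ℕ.<⇒≤ (Fin.toℕ<n x))) ⟩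
      residue n                              ≡⟨ ∣⇒residue≡0 ℕ.∣-refl ⟩
      0#                                     ∎

    assoc₊ : ∀ x y z → (x + y) + z ≡ x + (y + z)
    assoc₊ = lift₁ λ a → lift₁ λ b → lift₁ λ c → begin
      (residue a + residue b) + residue c  ≡⟨ cong (_+ residue c) (residue-+ a b) ⟩
      residue (a ℕ.+ b) + residue c        ≡⟨ residue-+ (a ℕ.+ b) c ⟩
      residue (a ℕ.+ b ℕ.+ c)              ≡⟨ cong residue (ℕ.+-assoc a b c) ⟩
      residue (a ℕ.+ (b ℕ.+ c))            ≡⟨ residue-+ a (b ℕ.+ c) ⟨
      residue a + residue (b ℕ.+ c)        ≡⟨ cong (residue a +_) (residue-+ b c) ⟨
      residue a + (residue b + residue c)  ∎

    assoc* : ∀ x y z → (x * y) * z ≡ x * (y * z)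
    assoc* = lift₁ λ a → lift₁ λ b → lift₁ λ c → begin
      (residue a * residue b) * residue c  ≡⟨ cong (_* residue c) (residue-* a b) ⟩
      residue (a ℕ.* b) * residue c        ≡⟨ residue-* (a ℕ.* b) c ⟩
      residue (a ℕ.* b ℕ.* c)              ≡⟨ cong residue (ℕ.*-assoc a b c) ⟩
      residue (a ℕ.* (b ℕ.* c))            ≡⟨ residue-* a (b ℕ.* c) ⟨
      residue a * residue (b ℕ.* c)        ≡⟨ cong (residue a *_) (residue-* b c) ⟨
      residue a * (residue b * residue c)  ∎

    distrib : ∀ x y z → x * (y + z) ≡ x * y + x * z
    distrib = lift₁ λ a → lift₁ λ b → lift₁ λ c → begin
      residue a * (residue b + residue c)              ≡⟨ cong (residue a *_) (residue-+ b c) ⟩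
      residue a * residue (b ℕ.+ c)                    ≡⟨ residue-* a (b ℕ.+ c) ⟩
      residue (a ℕ.* (b ℕ.+ c))                        ≡⟨ cong residue (ℕ.*-distribˡ-+ a b c) ⟩
      residue (a ℕ.* b ℕ.+ a ℕ.* c)                    ≡⟨ residue-+ (a ℕ.* b) (a ℕ.* c) ⟨
      residue (a ℕ.* b) + residue (a ℕ.* c)            ≡⟨ cong₂ _+_ (residue-* a b) (residue-* a c) ⟨
      residue a * residue b + residue a * residue c    ∎

  open IsCommutativeRing isCommutativeRing using (+-identityʳ; *-identityˡ; zeroˡ; -‿inverseʳ; distribʳ)
  open IntegerCoefficients isCommutativeRing using (ring)
  open import Algebra.Properties.Group (CommutativeRing.+-group ring)
    using (inverseʳ-unique; ⁻¹-involutive; ∙-cancelˡ; ⁻¹-injective; //-rightDividesˡ)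
  open import Algebra.Properties.Ring (CommutativeRing.ring ring) using (-‿distribˡ-*; -‿distribʳ-*)

  residue-≢ : ∀ a k → n ∤ k → residue a ≢ residue (a ℕ.+ k)
  residue-≢ a k n∤k e = n∤k (residue≡0⇒∣ (∙-cancelˡ (residue a) _ _ (begin
    residue a + residue k   ≡⟨ residue-+ a k ⟩
    residue (a ℕ.+ k)       ≡⟨ e ⟨
    residue a               ≡⟨ +-identityʳ _ ⟨
    residue a + 0#          ∎)))

  module _ (isPrime : Prime n) where

    -- A positive number below a prime is coprime to it, and Bézout's identity yields the inverse up
    -- to sign.
    inverse : ∀ x → x ≢ 0# → ∃[ y ] x * y ≡ 1#
    inverse x x≢0 = bézout (coprime-Bézout (prime⇒coprime isPrime {{ℕ.≢-nonZero m≢0}} (Fin.toℕ<n x)))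
      where
      m : ℕ
      m = toℕ x

      m≢0 : m ≢ 0
      m≢0 m≡0 = x≢0 (trans (sym (residue-toℕ x)) (cong residue m≡0))

      product : ∀ b → x * residue b ≡ residue (b ℕ.* m)
      product b = begin
        x * residue b          ≡⟨ cong (_* residue b) (residue-toℕ x) ⟨
        residue m * residue b  ≡⟨ residue-* m b ⟩
        residue (m ℕ.* b)      ≡⟨ cong residue (ℕ.*-comm m b) ⟩
        residue (b ℕ.* m)      ∎

      bézout : Bézout.Identity 1 n m → ∃[ y ] x * y ≡ 1#
      bézout (Bézout.-+ a b eq) = residue b , (begin
        x * residue b                  ≡⟨ product b ⟩
        residue (b ℕ.* m)              ≡⟨ cong residue eq ⟨
        residue (1 ℕ.+ a ℕ.* n)        ≡⟨ residue-+ 1 (a ℕ.* n) ⟨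
        1# + residue (a ℕ.* n)         ≡⟨ cong (1# +_) (∣⇒residue≡0 (ℕ.n∣m*n a)) ⟩
        1# + 0#                        ≡⟨ +-identityʳ 1# ⟩
        1#                             ∎)
      -- In this form of the identity `b m` is `- 1#` modulo `n`, hence the sign.
      bézout (Bézout.+- a b eq) = neg (residue b) , (begin
        x * neg (residue b)            ≡⟨ -‿distribʳ-* x (residue b) ⟨
        neg (x * residue b)            ≡⟨ cong neg (trans (product b) b*m≡-1) ⟩
        neg (neg 1#)                   ≡⟨ ⁻¹-involutive 1# ⟩
        1#                             ∎)
        where
        b*m≡-1 : residue (b ℕ.* m) ≡ neg 1#
        b*m≡-1 = inverseʳ-unique 1# _ (begin
          1# + residue (b ℕ.* m)       ≡⟨ residue-+ 1 (b ℕ.* m) ⟩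
          residue (1 ℕ.+ b ℕ.* m)      ≡⟨ cong residue eq ⟩
          residue (a ℕ.* n)            ≡⟨ ∣⇒residue≡0 (ℕ.n∣m*n a) ⟩
          0#                           ∎)

    open Fields isCommutativeRing inverse using (*-≢0; squares-≢)

    -- Conics and squares modulo an odd prime.

    module _ (odd : 2 ∤ n) where

      half : ∃[ h ] n ≡ suc (h ℕ.+ h)
      half = n ℕ./ 2 , (begin
        n                               ≡⟨ ℕ.m≡m%n+[m/n]*n n 2 ⟩
        n % 2 ℕ.+ n ℕ./ 2 ℕ.* 2         ≡⟨ cong₂ ℕ._+_ (n%2≡1 (n % 2) refl) (ℕ.*-comm (n ℕ./ 2) 2) ⟩
        1 ℕ.+ 2 ℕ.* (n ℕ./ 2)           ≡⟨ cong (λ k → suc (n ℕ./ 2 ℕ.+ k)) (ℕ.+-identityʳ _) ⟩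
        suc (n ℕ./ 2 ℕ.+ n ℕ./ 2)       ∎)
        where
        n%2≡1 : ∀ r → n % 2 ≡ r → r ≡ 1
        n%2≡1 0 e = contradiction (ℕ.m%n≡0⇒n∣m n 2 e) odd
        n%2≡1 1 e = refl
        n%2≡1 (suc (suc r)) e = contradiction (subst (_< 2) e (ℕ.m%n<n n 2)) λ { (s≤s (s≤s ())) }

      3≤n : 3 ≤ n
      3≤n = go n refl
        where
        go : ∀ k → n ≡ k → 3 ≤ k
        go 0 refl = contradiction isPrime ¬prime[0]
        go 1 refl = contradiction isPrime ¬prime[1]
        go 2 refl = contradiction ℕ.∣-refl odd
        go (suc (suc (suc k))) _ = s≤s (s≤s (s≤s z≤n))

      1+1≢0 : 1# + 1# ≢ 0#
      1+1≢0 e = ℕ.>⇒∤ 3≤n (residue≡0⇒∣ (trans (sym (residue-+ 1 1)) e))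

      -- Write `n = 2h + 1` and let `x`, `y` range over `0, …, h`. The `h + 1` values `u x²` are
      -- distinct, as are the `h + 1` values `c - v y²`. Since `2h + 2 > n`, a value of the first
      -- kind meets one of the second.
      conic : ∀ {u v} c → u ≢ 0# → v ≢ 0# → ∃₂ λ x y → u * (x * x) + v * (y * y) ≡ c
      conic {u} {v} c u≢0 v≢0 = from-half half
        where
        value₁ value₂ : ∀ {h} → Fin (suc h) → Fin n
        value₁ i = let x = residue (toℕ i) in u * (x * x)
        value₂ j = let y = residue (toℕ j) in c + neg (v * (y * y))

        -- Distinct `i`, `j` up to `h` have distinct residues and satisfy `0 < i + j ≤ 2h < n`, so
        -- `squares-≢` applies.
        value-≢ : ∀ {h w} → n ≡ suc (h ℕ.+ h) → w ≢ 0# → ∀ (i j : Fin (suc h)) → i ≢ j →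
                  let x = residue (toℕ i) ; y = residue (toℕ j) in w * (x * x) ≢ w * (y * y)
        value-≢ {h} n≡ w≢0 i j i≢j = squares-≢ w≢0 x≢y x+y≢0
          where
          bound : ∀ (i : Fin (suc h)) → toℕ i ≤ h
          bound i = ℕ.≤-pred (Fin.toℕ<n i)

          h<n : h < n
          h<n = subst (h <_) (sym n≡) (s≤s (ℕ.m≤m+n h h))

          x≢y : residue (toℕ i) ≢ residue (toℕ j)
          x≢y e = i≢j (Fin.toℕ-injective (begin
            toℕ i                      ≡⟨ ℕ.m<n⇒m%n≡m (ℕ.≤-<-trans (bound i) h<n) ⟨
            toℕ i % n                  ≡⟨ toℕ-residue (toℕ i) ⟨
            toℕ (residue (toℕ i))      ≡⟨ cong toℕ e ⟩
            toℕ (residue (toℕ j))      ≡⟨ toℕ-residue (toℕ j) ⟩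
            toℕ j % n                  ≡⟨ ℕ.m<n⇒m%n≡m (ℕ.≤-<-trans (bound j) h<n) ⟩
            toℕ j                      ∎))

          -- The sum is generalised to `k` so that matching on `suc` provides the nonzeroness that
          -- `ℕ.>⇒∤` asks for.
          i+j≡0 : ∀ k → k ≡ toℕ i ℕ.+ toℕ j → n ∣ k → k ≡ 0
          i+j≡0 zero    _ _   = refl
          i+j≡0 (suc k) e n∣k = contradiction n∣k (ℕ.>⇒∤
            (subst₂ _<_ (sym e) (sym n≡) (s≤s (ℕ.+-mono-≤ (bound i) (bound j)))))

          x+y≢0 : residue (toℕ i) + residue (toℕ j) ≢ 0#
          x+y≢0 e = i≢j (Fin.toℕ-injective (trans (ℕ.m+n≡0⇒m≡0 (toℕ i) sum≡0) (sym (ℕ.m+n≡0⇒n≡0 (toℕ i) sum≡0))))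
            where
            sum≡0 : toℕ i ℕ.+ toℕ j ≡ 0
            sum≡0 = i+j≡0 _ refl (residue≡0⇒∣ (trans (sym (residue-+ (toℕ i) (toℕ j))) e))

        solution : ∀ {h} (i j : Fin (suc h)) → value₁ i ≡ value₂ j →
                   ∃₂ λ x y → u * (x * x) + v * (y * y) ≡ c
        solution i j e = x , y , (begin
          u * (x * x) + v * (y * y)                      ≡⟨ cong (_+ v * (y * y)) e ⟩
          (c + neg (v * (y * y))) + v * (y * y)          ≡⟨ //-rightDividesˡ (v * (y * y)) c ⟩
          c                                              ∎)
          where
          x y : Fin n
          x = residue (toℕ i)
          y = residue (toℕ j)

        collide : ∀ {h} → n ≡ suc (h ℕ.+ h) → (i j : Fin (suc h) ⊎ Fin (suc h)) →
                  [ value₁ , value₂ ]′ i ≡ [ value₁ , value₂ ]′ j → i ≢ j →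
                  ∃₂ λ x y → u * (x * x) + v * (y * y) ≡ c
        collide n≡ (inj₁ i) (inj₁ j) e i≢j = contradiction e (value-≢ n≡ u≢0 i j (i≢j ∘ cong inj₁))
        collide _ (inj₁ i) (inj₂ j) e _ = solution i j e
        collide _ (inj₂ i) (inj₁ j) e _ = solution j i (sym e)
        collide n≡ (inj₂ i) (inj₂ j) e i≢j =
          contradiction (⁻¹-injective (∙-cancelˡ c _ _ e)) (value-≢ n≡ v≢0 i j (i≢j ∘ cong inj₂))

        from-half : ∃[ h ] n ≡ suc (h ℕ.+ h) → ∃₂ λ x y → u * (x * x) + v * (y * y) ≡ c
        from-half (h , n≡)
          with i , j , i<j , e ← Fin.pigeonhole
                 (subst (_< suc h ℕ.+ suc h) (sym n≡) (s≤s (ℕ.≤-reflexive (sym (ℕ.+-suc h h)))))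
                 ([ value₁ , value₂ ]′ ∘ Fin.splitAt (suc h))
          = collide n≡ (Fin.splitAt (suc h) i) (Fin.splitAt (suc h) j) e
              (λ e′ → Fin.<⇒≢ i<j (begin
                i                                                ≡⟨ Fin.join-splitAt (suc h) (suc h) i ⟨
                Fin.join (suc h) (suc h) (Fin.splitAt (suc h) i) ≡⟨ cong (Fin.join (suc h) (suc h)) e′ ⟩
                Fin.join (suc h) (suc h) (Fin.splitAt (suc h) j) ≡⟨ Fin.join-splitAt (suc h) (suc h) j ⟩
                j                                                ∎))

      -- If every residue were a square, square roots r would be an injection
      -- missing - r 1, since (- r 1)² = 1.
      nonsquare : ∃[ w ] w ≢ 0# × (∀ x → w ≢ x * x)
      nonsquare with Fin.any? (λ w → Fin.all? (λ x → ¬? (w Fin.≟ x * x)))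
      ... | yes (w , w≢) = w , (λ w≡0 → w≢ 0# (trans w≡0 (sym (zeroˡ 0#)))) , w≢
      ... | no all-squares = contradiction collision
              λ { (Fin.zero , Fin.suc w , _ , e) → missed w e
                ; (Fin.suc v , Fin.suc w , s≤s v<w , e) → Fin.<⇒≢ v<w (trans (root² v) (trans (cong₂ _*_ e e) (sym (root² w)))) }
        where
        root-of : ∀ w → ∃[ x ] w ≡ x * x
        root-of w with Fin.any? (λ x → w Fin.≟ x * x)
        ... | yes r = r
        ... | no ¬r = contradiction (w , λ x e → ¬r (x , e)) all-squares

        root : Fin n → Fin n
        root w = proj₁ (root-of w)

        root² : ∀ w → w ≡ root w * root w
        root² w = proj₂ (root-of w)

        roots : Fin (suc n) → Fin n
        roots Fin.zero    = neg (root 1#)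
        roots (Fin.suc w) = root w

        collision : ∃₂ λ i j → i Fin.< j × roots i ≡ roots j
        collision = Fin.pigeonhole ℕ.≤-refl roots

        -- Squaring forces `w = 1#`, as `- r` also has square `1#`. Then `r = - r`, impossible
        -- because `1# + 1#` and `r` are nonzero.
        missed : ∀ w → neg (root 1#) ≢ root w
        missed w e = *-≢0 1+1≢0 r≢0 (begin
          (1# + 1#) * r      ≡⟨ distribʳ r 1# 1# ⟩
          1# * r + 1# * r    ≡⟨ cong (λ s → s + s) (*-identityˡ r) ⟩
          r + r              ≡⟨ cong (r +_) r≡-r ⟩
          r + neg r          ≡⟨ -‿inverseʳ r ⟩
          0#                 ∎)
          where
          r : Fin n
          r = root 1#

          r≢0 : r ≢ 0#
          r≢0 r≡0 = 1+1≢0 (begin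
            1# + 1#          ≡⟨ cong (λ z → z + z) (trans (root² 1#) (trans (cong (_* r) r≡0) (zeroˡ r))) ⟩
            0# + 0#          ≡⟨ +-identityʳ 0# ⟩
            0#               ∎)

          w≡1 : w ≡ 1#
          w≡1 = begin
            w                ≡⟨ root² w ⟩
            root w * root w  ≡⟨ cong₂ _*_ e e ⟨
            neg r * neg r    ≡⟨ trans (sym (-‿distribˡ-* r (neg r))) (cong neg (sym (-‿distribʳ-* r r))) ⟩
            neg (neg (r * r)) ≡⟨ ⁻¹-involutive (r * r) ⟩
            r * r            ≡⟨ root² 1# ⟨
            1#               ∎

          r≡-r : r ≡ neg r
          r≡-r = trans (sym (cong root w≡1)) (sym e)

      module _ (7≤n : 7 ≤ n) where

        -- The squares 1, 4, 9 differ by 3, 5 and 8, none divisible by a prime `n ≥ 7`. Two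
        -- prescribed values cannot exhaust three distinct ones.
        avoid : ∀ c d → ∃[ x ] x ≢ 0# × x * x ≢ c × x * x ≢ d
        avoid c d = choose
          where
          small : ∀ k .{{_ : NonZero k}} → k < 7 → n ∤ k
          small k k<7 = ℕ.>⇒∤ (ℕ.<-≤-trans k<7 7≤n)

          -- The bound `7 ≤ n` does not settle 8 by size, so primality reduces it to the factors 2
          -- and 4.
          n∤8 : n ∤ 8
          n∤8 n∣8 = [ small 2 (from-yes (2 ℕ.<? 7)) , small 4 (from-yes (4 ℕ.<? 7)) ]′ (euclidsLemma 2 4 isPrime n∣8)

          nonzero : ∀ k .{{_ : NonZero k}} → k < 7 → residue k ≢ 0#
          nonzero k k<7 e = small k k<7 (residue≡0⇒∣ e)

          sq : ∀ k → residue k * residue k ≡ residue (k ℕ.* k)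
          sq k = residue-* k k

          1²≢2² : residue 1 * residue 1 ≢ residue 2 * residue 2
          1²≢2² e = residue-≢ 1 3 (small 3 (from-yes (3 ℕ.<? 7))) (trans (sym (sq 1)) (trans e (sq 2)))

          2²≢3² : residue 2 * residue 2 ≢ residue 3 * residue 3
          2²≢3² e = residue-≢ 4 5 (small 5 (from-yes (5 ℕ.<? 7))) (trans (sym (sq 2)) (trans e (sq 3)))

          1²≢3² : residue 1 * residue 1 ≢ residue 3 * residue 3
          1²≢3² e = residue-≢ 1 8 n∤8 (trans (sym (sq 1)) (trans e (sq 3)))

          1≢0 : residue 1 ≢ 0#
          1≢0 = nonzero 1 (from-yes (1 ℕ.<? 7))

          2≢0 : residue 2 ≢ 0#
          2≢0 = nonzero 2 (from-yes (2 ℕ.<? 7))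

          3≢0 : residue 3 ≢ 0#
          3≢0 = nonzero 3 (from-yes (3 ℕ.<? 7))

          choose : ∃[ x ] x ≢ 0# × x * x ≢ c × x * x ≢ d
          choose with residue 1 * residue 1 Fin.≟ c | residue 1 * residue 1 Fin.≟ d
                    | residue 2 * residue 2 Fin.≟ c | residue 2 * residue 2 Fin.≟ d
          ... | no 1≢c   | no 1≢d   | _        | _      = residue 1 , 1≢0 , 1≢c , 1≢d
          ... | _        | _        | no 2≢c   | no 2≢d = residue 2 , 2≢0 , 2≢c , 2≢d
          ... | yes 1≡c  | _        | yes 2≡c  | _      = contradiction (trans 1≡c (sym 2≡c)) 1²≢2²
          ... | _        | yes 1≡d  | _        | yes 2≡d = contradiction (trans 1≡d (sym 2≡d)) 1²≢2²
          ... | yes refl | _        | _        | yes refl = residue 3 , 3≢0 , 1²≢3² ∘ sym , 2²≢3² ∘ sym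
          ... | _        | yes refl | yes refl | _      = residue 3 , 3≢0 , 2²≢3² ∘ sym , 1²≢3² ∘ sym

        largeField : LargeField
        largeField = record
          { isCommutativeRing = isCommutativeRing
          ; _≟_ = Fin._≟_
          ; inverse = inverse
          ; 1+1≢0 = 1+1≢0
          ; avoid = avoid
          ; conic = conic
          }

-- Passage between weighted sums over lists and subsequences of vectors.

module Sequences (n : ℕ) .{{_ : NonZero n}} where
  open Defs using (_*_)
  open Residues n using (isCommutativeRing)
  open WeightedSums isCommutativeRing Q public

  toVec : ∀ {l k s t} → WeightedSum l k s t →
          Σ[ ys ∈ Vec (Fin n) k ] toList ys ⊆ l ×
          Σ[ as ∈ Vec (Fin n) k ] VecAll.All Q as × sum (Vec.zipWith _*_ as ys) ≡ s × sum as ≡ t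
  toVec none = [] , [] , [] , [] , refl , refl
  toVec (drop w) with ys , τ , rest ← toVec w = ys , _ ∷ʳ τ , rest
  toVec (pick q w) with ys , τ , as , qs , refl , refl ← toVec w =
    _ ∷ ys , refl ∷ τ , _ ∷ as , q ∷ qs , refl , refl

  fromVec : ∀ {l k} (ys as : Vec (Fin n) k) → toList ys ⊆ l → VecAll.All Q as →
            WeightedSum l k (sum (Vec.zipWith _*_ as ys)) (sum as)
  fromVec []       []       []       []       = none
  fromVec ys       as       (_ ∷ʳ τ) qs       = drop (fromVec ys as τ qs)
  fromVec (y ∷ ys) (a ∷ as) (refl ∷ τ) (q ∷ qs) = pick q (fromVec ys as τ qs)

  subsequence : ∀ {k} (xs : Vec (Fin n) k) → WeightedSum (toList xs) n 0# 0# →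
                HasWeightedZeroSumSubsequence n xs
  subsequence xs w = toVec w

  weightedSum : ∀ {k} {xs : Vec (Fin n) k} {l} → toList xs ⊆ l → HasWeightedZeroSumSubsequence n xs →
                WeightedSum l n 0# 0#
  weightedSum xs⊆l (ys , ys⊆xs , as , qs , s≡0 , t≡0) =
    subst₂ (WeightedSum _ _) s≡0 t≡0 (fromVec ys as (⊆-trans ys⊆xs xs⊆l) qs)

truncate-⊆ : ∀ {A : Set} {m n} (m≤n : m ≤ n) (xs : Vec A n) → toList (Vec.truncate m≤n xs) ⊆ toList xs
truncate-⊆ z≤n       xs       = minimum (toList xs)
truncate-⊆ (s≤s m≤n) (x ∷ xs) = refl ∷ truncate-⊆ m≤n xs

-- The lower bound.

module LowerBound (n : ℕ) .{{_ : NonZero n}} (isPrime : Prime n) (odd : 2 ∤ n) where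
  open Defs using (_+_; _*_)
  open Residues n
  open Sequences n
  open IsCommutativeRing isCommutativeRing
    using (+-identityʳ; *-identityˡ; *-identityʳ; zeroˡ)
  open IntegerCoefficients isCommutativeRing using (ring; solve; _:=_; _:*_)
  open import Algebra.Properties.Group (CommutativeRing.+-group ring) using (x∙y⁻¹≈ε⇒x≈y; ε⁻¹≈ε; ⁻¹-injective)
  open import Algebra.Properties.Ring (CommutativeRing.ring ring) using (-‿distribʳ-*)
  open Fields isCommutativeRing (inverse isPrime) using (*-≢0)
  open ≡-Reasoning

  Q⇒≢0 : ∀ {a} → Q a → a ≢ 0#
  Q⇒≢0 (x , (y , xy≡1) , refl) = *-≢0 x≢0 x≢0
    where
    x≢0 : x ≢ 0#
    x≢0 x≡0 = 1+1≢0 isPrime odd (begin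
      1# + 1#          ≡⟨ cong (λ z → z + z) xy≡1 ⟨
      x * y + x * y    ≡⟨ cong (λ z → z + z) (trans (cong (_* y) x≡0) (zeroˡ y)) ⟩
      0# + 0#          ≡⟨ +-identityʳ 0# ⟩
      0#               ∎)

  -- Picking more entries than there are zeros involves `1#` or `- w`. One of them alone contributes
  -- a nonzero sum. Both together give `x² = y² w`, so that `w` is the square of `x / y`.
  no-zero-sum : ∀ {m w k s t} → w ≢ 0# → (∀ x → w ≢ x * x) → m < k →
                WeightedSum (1# ∷ neg w ∷ List.replicate m 0#) k s t → s ≢ 0#
  no-zero-sum {m} {w} w≢0 nonsq m<k = cases m<k
    where
    rest≡0 : ∀ {k s t} → WeightedSum (List.replicate m 0#) k s t → s ≡ 0#
    rest≡0 {t = t} v = trans (replicate-sum m 0# v) (zeroˡ t)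

    -w≢0 : neg w ≢ 0#
    -w≢0 e = w≢0 (⁻¹-injective (trans e (sym ε⁻¹≈ε)))

    cases : ∀ {k s t} → m < k → WeightedSum (1# ∷ neg w ∷ List.replicate m 0#) k s t → s ≢ 0#
    cases m<k (drop (drop v)) _ =
      ℕ.<⇒≱ m<k (subst (_ ≤_) (List.length-replicate m) (size≤length v))
    cases _ (drop (pick {s = s} {a = b} qb v)) e = *-≢0 (Q⇒≢0 qb) -w≢0 (begin
      b * neg w        ≡⟨ +-identityʳ _ ⟨
      b * neg w + 0#   ≡⟨ cong (b * neg w +_) (rest≡0 v) ⟨
      b * neg w + s    ≡⟨ e ⟩
      0#               ∎)
    cases _ (pick {s = s} {a = a} qa (drop v)) e = Q⇒≢0 qa (begin
      a                ≡⟨ *-identityʳ a ⟨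
      a * 1#           ≡⟨ +-identityʳ _ ⟨
      a * 1# + 0#      ≡⟨ cong (a * 1# +_) (rest≡0 v) ⟨
      a * 1# + s       ≡⟨ e ⟩
      0#               ∎)
    cases _ (pick (x , _ , refl) (pick {s = s} (y , (y′ , yy′≡1) , refl) v)) e =
      nonsq (x * y′) (begin
        w                          ≡⟨ *-identityʳ w ⟨
        w * 1#                     ≡⟨ cong (w *_) (trans (sym (*-identityˡ 1#)) (cong (λ z → z * z) (sym yy′≡1))) ⟩
        w * ((y * y′) * (y * y′))  ≡⟨ regroup w y y′ ⟩
        (y * y * w) * (y′ * y′)    ≡⟨ cong (_* (y′ * y′)) x²≡y²w ⟨
        (x * x) * (y′ * y′)        ≡⟨ regroup′ x y′ ⟩
        (x * y′) * (x * y′)        ∎)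
      where
      regroup : ∀ w y y′ → w * ((y * y′) * (y * y′)) ≡ (y * y * w) * (y′ * y′)
      regroup = solve 3 (λ w y y′ → w :* ((y :* y′) :* (y :* y′)) := (y :* y :* w) :* (y′ :* y′)) refl

      regroup′ : ∀ x y′ → (x * x) * (y′ * y′) ≡ (x * y′) * (x * y′)
      regroup′ = solve 2 (λ x y′ → (x :* x) :* (y′ :* y′) := (x :* y′) :* (x :* y′)) refl

      x²≡y²w : x * x ≡ y * y * w
      x²≡y²w = x∙y⁻¹≈ε⇒x≈y _ _ (begin
        x * x + neg (y * y * w)               ≡⟨ cong₂ _+_ (sym (*-identityʳ (x * x))) (-‿distribʳ-* (y * y) w) ⟩
        x * x * 1# + (y * y) * neg w          ≡⟨ cong (x * x * 1# +_) (+-identityʳ _) ⟨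
        x * x * 1# + (y * y * neg w + 0#)     ≡⟨ cong (λ z → x * x * 1# + (y * y * neg w + z)) (rest≡0 v) ⟨
        x * x * 1# + (y * y * neg w + s)      ≡⟨ e ⟩
        0#                                    ∎)

  -- If `j` were at most `n + 1`, the first `j` terms of `bad` would contain a zero-sum choice of
  -- `n` terms, and hence so would `bad`.
  lower-bound : ∀ j → ((xs : Vec (Fin n) j) → HasWeightedZeroSumSubsequence n xs) → n ℕ.+ 2 ≤ j
  lower-bound j P with w , w≢0 , nonsq ← nonsquare isPrime odd with n ℕ.+ 2 ℕ.≤? j
  ... | yes n+2≤j = n+2≤j
  ... | no n+2≰j =
    contradiction refl (no-zero-sum w≢0 nonsq (ℕ.≤-reflexive (ℕ.suc-pred n))
      (subst (λ l → WeightedSum (1# ∷ neg w ∷ l) n 0# 0#) (Vec.toList-replicate (ℕ.pred n) 0#)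
        (weightedSum (truncate-⊆ j≤n+1 bad) (P (Vec.truncate j≤n+1 bad)))))
    where
    bad : Vec (Fin n) (2 ℕ.+ ℕ.pred n)
    -- There are `n - 1` zeros, one fewer than the terms to be picked.
    bad = 1# ∷ neg w ∷ Vec.replicate (ℕ.pred n) 0#

    j≤n+1 : j ≤ 2 ℕ.+ ℕ.pred n
    j≤n+1 = ℕ.≤-pred (subst (suc j ≤_) (trans (ℕ.+-comm n 2) (cong (2 ℕ.+_) (sym (ℕ.suc-pred n)))) (ℕ.≰⇒> n+2≰j))

-- The upper bound for primes at least 7.

module UpperBound (n : ℕ) .{{_ : NonZero n}} (isPrime : Prime n) (odd : 2 ∤ n) (7≤n : 7 ≤ n) where
  open Residues n
  open Sequences n
  open Multiplicity (Fin._≟_ {n})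
  open Selection (largeField isPrime odd 7≤n) using (triple-zero-sum; pairs-zero-sum)

  zero-sum : ∀ l → length l ≡ n ℕ.+ 2 → WeightedSum l n 0# 0#
  zero-sum l |l|≡n+2 with triple-or-two-pairs unique-length l (ℕ.≤-reflexive (sym |l|≡n+2)) (3≤n isPrime odd)
  -- All further copies of `x` are collected, so that `r` is free of `x`.
  ... | inj₁ (x , l′ , p) with m , r , r≢x , q ← gather x l′ =
    permute (↭-sym p′) (triple-zero-sum x r≢x (s≤s (s≤s (s≤s z≤n))) (ℕ.≤-trans (ℕ.n≤1+n 6) 7≤n) total)
    where
    p′ : l ↭ List.replicate (3 ℕ.+ m) x ++ r
    p′ = ↭-trans p (prep x (prep x (prep x q)))

    total : 3 ℕ.+ m ℕ.+ length r ≡ n ℕ.+ 2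
    total = trans (cong (ℕ._+ length r) (sym (List.length-replicate (3 ℕ.+ m))))
      (trans (sym (List.length-++ (List.replicate (3 ℕ.+ m) x))) (trans (sym (↭-length p′)) |l|≡n+2))
  ... | inj₂ (x , y , z , l′ , x≢y , z≢x , z≢y , p)
    -- The pairs and `z` account for five terms; the other `k = n - 5` come from `l′`, which has
    -- `n - 3`.
    with k , 5+k≡n ← ℕ.m≤n⇒∃[o]m+o≡n (ℕ.≤-trans (ℕ.m≤m+n 5 2) 7≤n) =
    permute (↭-sym p) (subst (λ n′ → WeightedSum (x ∷ x ∷ y ∷ y ∷ z ∷ l′) n′ 0# 0#) 5+k≡n
      (pairs-zero-sum x≢y z≢x z≢y (ℕ.+-cancelˡ-≤ 5 k (length l′) k≤)))
    where
    k≤ : 5 ℕ.+ k ≤ 5 ℕ.+ length l′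
    k≤ = subst₂ _≤_ (sym 5+k≡n) (trans (sym |l|≡n+2) (↭-length p)) (ℕ.m≤m+n n 2)

-- The upper bound for the prime 3.

module Three where
  open Defs using (_+_; _*_)
  open Sequences 3
  open Multiplicity (Fin._≟_ {3})

  unit : Q {3} 1#
  unit = 1# , (1# , refl) , refl

  triple : ∀ (x : Fin 3) → 1# * x + (1# * x + (1# * x + 0#)) ≡ 0#
  triple = toWitness {a? = Fin.all? λ x → 1# * x + (1# * x + (1# * x + 0#)) Fin.≟ 0#} _

  -- Three distinct residues modulo 3 are 0, 1, 2 in some order, with sum 3.
  distinct : ∀ (x y z : Fin 3) → x ≢ y → z ≢ x → z ≢ y → 1# * x + (1# * y + (1# * z + 0#)) ≡ 0#
  distinct = toWitness {a? = Fin.all? λ x → Fin.all? λ y → Fin.all? λ z →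
    ¬? (x Fin.≟ y) →-dec ¬? (z Fin.≟ x) →-dec ¬? (z Fin.≟ y) →-dec
    1# * x + (1# * y + (1# * z + 0#)) Fin.≟ 0#} _

  zero-sum : ∀ l → length l ≡ 5 → WeightedSum l 3 0# 0#
  zero-sum l |l|≡5 with triple-or-two-pairs unique-length l (ℕ.≤-reflexive (sym |l|≡5)) ℕ.≤-refl
  ... | inj₁ (x , l′ , p) =
    permute (↭-sym p) (subst (λ s → WeightedSum (x ∷ x ∷ x ∷ l′) 3 s 0#) (triple x)
      (pick unit (pick unit (pick unit (dropAll l′)))))
  ... | inj₂ (x , y , z , l′ , x≢y , z≢x , z≢y , p) =
    permute (↭-sym p) (subst (λ s → WeightedSum (x ∷ x ∷ y ∷ y ∷ z ∷ l′) 3 s 0#) (distinct x y z x≢y z≢x z≢y)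
      -- One copy each of `x`, `y` and `z` is kept; the weights `1# + 1# + 1#` vanish by
      -- computation.
      (drop (pick unit (drop (pick unit (pick unit (dropAll l′)))))))

-- Assembly for all odd primes other than 5.

7≤prime : ∀ {p} → Prime p → 2 ∤ p → p ≢ 3 → p ≢ 5 → 7 ≤ p
7≤prime {0} isPrime _ _ _ = contradiction isPrime ¬prime[0]
7≤prime {1} isPrime _ _ _ = contradiction isPrime ¬prime[1]
7≤prime {2} _ odd _ _ = contradiction (ℕ.m∣m*n 1) odd
7≤prime {3} _ _ p≢3 _ = contradiction refl p≢3
7≤prime {4} _ odd _ _ = contradiction (ℕ.m∣m*n 2) odd
7≤prime {5} _ _ _ p≢5 = contradiction refl p≢5
7≤prime {6} _ odd _ _ = contradiction (ℕ.m∣m*n 3) odd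
7≤prime {suc (suc (suc (suc (suc (suc (suc _))))))} _ _ _ _ = ℕ.m≤m+n 7 _

zero-sum : ∀ p .{{_ : NonZero p}} → Prime p → 2 ∤ p → p ≢ 5 →
           ∀ l → length l ≡ p ℕ.+ 2 → Sequences.WeightedSum p l p 0# 0#
zero-sum p isPrime odd p≢5 with p ℕ.≟ 3
... | yes refl = Three.zero-sum
... | no p≢3   = UpperBound.zero-sum p isPrime odd (7≤prime isPrime odd p≢3 p≢5)

open import Data.Nat using (_+_)

theorem2p14 : (p : ℕ) .{{_ : NonZero p}} → Prime p → 2 ∤ p → p ≢ 5 →
    E[Q,1]≡ p (p + 2)
theorem2p14 p isPrime odd p≢5 =
  subst (0 <_) (ℕ.+-comm 2 p) (s≤s z≤n) ,
  (λ xs → Sequences.subsequence p xs (zero-sum p isPrime odd p≢5 (toList xs) (Vec.length-toList xs))) ,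
  λ j _ → LowerBound.lower-bound p isPrime odd j
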